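{- Let $b \ge 2$ be an integer. If a positive integer $n$ is not a comma-child in base $b$ of any positive integer, then $1 \le n \le b^2-1$.
   Context: Fix a base $b \ge 2$. For a positive integer $n$, let $\delta(n)$ denote its leading (most significant, nonzero) base-$b$ digit. For positive integers $k, k'$, we say that $k'$ is a comma-child of $k$ (in base $b$) if $k' - k = d\cdot b + \delta(k')$, where $d = k \bmod b$ is the last base-$b$ digit of $k$. -}

module Defs where

open import Data.Digit using (Expansion; toDigits)
open import Data.Fin.Base using (toℕ)
open import Data.Integer.Base using (+_; _-_)
open import Data.List.Base using (filter; last; map)
open import Data.Maybe.Base using (fromMaybe)
open import Data.Nat.Base
  using (ℕ; _+_; _*_; _%_; NonTrivial; nonTrivial⇒n>1; nonTrivial⇒nonZero)
open import Data.Nat.Properties using (_≟_)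
open import Data.Product.Base using (proj₁)
open import Relation.Binary.PropositionalEquality using (_≡_)
open import Relation.Nullary.Decidable using (¬?; fromWitness)

-- `NonTrivial b` is the library's instance form of b ≥ 2.

digits : (b : ℕ) .{{_ : NonTrivial b}} → ℕ → Expansion b
digits b n = proj₁ (toDigits b {fromWitness (nonTrivial⇒n>1 b)} n)

-- `toDigits` lists the least significant digit first, so the most significant
-- nonzero digit is the last nonzero entry. The default 0 is reached only at
-- n = 0, where there is no leading digit.

δ : (b : ℕ) .{{_ : NonTrivial b}} → ℕ → ℕ
δ b n = fromMaybe 0 (last (filter (λ d → ¬? (d ≟ 0)) (map toℕ (digits b n))))

-- k′ is a comma-child of k; meaningful for positive k and k′. The difference
-- is taken in ℤ so that it is not truncated.

IsCommaChild : (b : ℕ) .{{_ : NonTrivial b}} → (k′ k : ℕ) → Set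
IsCommaChild b k′ k = + k′ - + k ≡ + (d * b + δ b k′)
  where
  instance _ = nonTrivial⇒nonZero b
  d = k % b

{-# OPTIONS --safe #-}

-- Given n, the last digit d of a parent k is forced: k ≡ n − δ(n) modulo b, so
-- d = (n − δ(n)) mod b and k = n − δ(n) − d b. This k is a parent as soon as it
-- is positive, and δ(n) + d b ≤ (b − 1) + (b − 1) b = b² − 1 makes it positive
-- for every n ≥ b².
module Submission where

open import Defs
open import Data.Fin.Base using (toℕ)
open import Data.Fin.Properties using (toℕ<n)
open import Data.Integer.Base using (+_)
open import Data.Integer.Properties using (m-n≡m⊖n; ⊖-≥)
import Data.List.Relation.Unary.All as List
import Data.List.Relation.Unary.All.Properties as List
open import Data.Maybe.Base using (Maybe; fromMaybe)
open import Data.Maybe.Relation.Unary.All as Maybe using (just; nothing)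
open import Data.Nat.Base
  using ( ℕ; suc; _+_; _*_; _%_; _≤_; _<_; _^_; _∸_; NonTrivial
        ; >-nonZero⁻¹; nonTrivial⇒nonZero)
open import Data.Nat.DivMod using (m%n<n; m*n≤o⇒[o∸m*n]%n≡o%n)
open import Data.Nat.Properties
open import Data.Product.Base using (_×_; ∃-syntax; _,_)
open import Relation.Binary.PropositionalEquality
  using (_≡_; cong; subst; module ≡-Reasoning)
open import Relation.Nullary.Decidable using (¬?)
open import Relation.Nullary.Negation.Core using (¬_)

fromMaybe⁺ : ∀ {a p} {A : Set a} {P : A → Set p} {x : A} {m : Maybe A} →
             P x → Maybe.All P m → P (fromMaybe x m)
fromMaybe⁺ px nothing   = px
fromMaybe⁺ _  (just py) = py

-- Digits come from `Fin b`, and the bound survives `filter` and `last`; the default 0 also obeys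
-- it, since `b` is positive.
δ<b : ∀ b .{{_ : NonTrivial b}} n → δ b n < b
δ<b b n = fromMaybe⁺ {P = _< b} (>-nonZero⁻¹ b {{nonTrivial⇒nonZero b}})
  (List.last⁺ (List.filter⁺ (λ d → ¬? (d ≟ 0))
    (List.map⁺ (List.universal {P = λ i → toℕ i < b} toℕ<n (digits b n)))))

d*b+r<b*b : ∀ {b d r} → d < b → r < b → d * b + r < b * b
d*b+r<b*b {b} {d} {r} d<b r<b = begin-strict
  d * b + r <⟨ +-monoʳ-< (d * b) r<b ⟩
  d * b + b ≡⟨ +-comm (d * b) b ⟩
  suc d * b ≤⟨ *-monoˡ-≤ b d<b ⟩
  b * b     ∎
  where open ≤-Reasoning

-- Lets a parent be checked by addition in ℕ: the equation forces `k ≤ n`, so the integer difference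
-- agrees with `n ∸ k`.
isCommaChild⁺ : ∀ b .{{_ : NonTrivial b}} {n k} →
                let instance _ = nonTrivial⇒nonZero b in
                k + (k % b * b + δ b n) ≡ n → IsCommaChild b n k
isCommaChild⁺ b {n} {k} k+x≡n = begin
  _             ≡⟨ m-n≡m⊖n n k ⟩
  _             ≡⟨ ⊖-≥ (subst (k ≤_) k+x≡n (m≤m+n k _)) ⟩
  + (n ∸ k)     ≡⟨ cong (λ m → + (m ∸ k)) k+x≡n ⟨
  + (k + x ∸ k) ≡⟨ cong +_ (m+n∸m≡n k x) ⟩
  + x           ∎
  where
  open ≡-Reasoning
  instance _ = nonTrivial⇒nonZero b
  x = k % b * b + δ b n

b*b≤n⇒parent : ∀ b .{{_ : NonTrivial b}} {n} → b * b ≤ n →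
               ∃[ k ] (1 ≤ k × IsCommaChild b n k)
b*b≤n⇒parent b {n} b*b≤n = k , m+n≤o⇒m≤o∸n 1 d*b<m , isCommaChild⁺ b (begin
  k + (k % b * b + δ b n) ≡⟨ cong (λ e → k + (e * b + δ b n)) k%b≡d ⟩
  k + (d * b + δ b n)     ≡⟨ +-assoc k (d * b) (δ b n) ⟨
  k + d * b + δ b n       ≡⟨ cong (_+ δ b n) (m∸n+n≡m (<⇒≤ d*b<m)) ⟩
  m + δ b n               ≡⟨ m∸n+n≡m (m+n≤o⇒n≤o (suc (d * b)) d*b+δ<n) ⟩
  n                       ∎)
  where
  open ≡-Reasoning
  instance _ = nonTrivial⇒nonZero b
  m = n ∸ δ b n
  -- Read off `m` because `k` is itself defined from `d`; `k%b≡d` closes the circle.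
  d = m % b
  k = m ∸ d * b

  -- This bound makes both truncated subtractions exact; its strictness makes `k` positive.
  d*b+δ<n : d * b + δ b n < n
  d*b+δ<n = <-≤-trans (d*b+r<b*b (m%n<n m b) (δ<b b n)) b*b≤n

  d*b<m : d * b < m
  d*b<m = m+n≤o⇒m≤o∸n (suc (d * b)) d*b+δ<n

  -- Removing a multiple of `b` no larger than `m` keeps the remainder.
  k%b≡d : k % b ≡ d
  k%b≡d = m*n≤o⇒[o∸m*n]%n≡o%n d (<⇒≤ d*b<m)

theorem5p5 : (b : ℕ) .{{_ : NonTrivial b}} (n : ℕ) → 1 ≤ n →
    ¬ (∃[ k ] (1 ≤ k × IsCommaChild b n k)) →
    1 ≤ n × n ≤ b ^ 2 ∸ 1
theorem5p5 b n 1≤n orphan = 1≤n , <⇒≤pred (≰⇒> λ b^2≤n →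
  -- `b ^ 2` unfolds to `b * (b * 1)`, so the trailing factor 1 has to be removed.
  orphan (b*b≤n⇒parent b (subst (_≤ n) (cong (b *_) (*-identityʳ b)) b^2≤n)))
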